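{- Let $D$ be a digraph. Then $\mathrm{dbw}(D)=\mathrm{hbw}(\mathcal{C}(D)^{*})$, i.e. the directed branchwidth of $D$ equals the hyperbranch-width of the dual of the cycle hypergraph of $D$.
   Context: All digraphs $D=(V(D),E(D))$ are finite, nonempty and simple: no loops and no parallel edges, but both $(u,v)$ and $(v,u)$ may be present (a digon). A directed cycle has pairwise distinct vertices; a digon is a directed cycle of length $2$. For a tree $T$ and an edge $t_1t_2\in E(T)$ let $T_{t_i}$ be the component of $T-t_1t_2$ containing $t_i$. If $\delta$ is a function defined on the leaves of $T$, let $\delta(T_{t_i})$ be the set (family) of images of the leaves of $T$ lying in $T_{t_i}$. A tree consisting of a single vertex is regarded as having one leaf, and then the widths below are $0$. Directed branchwidth. A directed branch decomposition of $D$ is a pair $(T,\delta)$ where $T$ is an undirected tree of maximum degree at most three and $\delta$ is a bijection from the leaves of $T$ to $V(D)$. The thickness of $t_1t_2\in E(T)$ is the minimum size of a set $S\subseteq V(D)$ that meets every directed cycle of $D$ having a vertex in $\delta(T_{t_1})$ and a vertex in $V(D)\setminus\delta(T_{t_1})$. The width of $(T,\delta)$ is the maximum thickness of an edge of $T$, and $\mathrm{dbw}(D)$ is the minimum width of a directed branch decomposition of $D$. Cycle hypergraph and its dual. Hypergraphs may have multiple hyperedges. The cycle hypergraph $\mathcal{C}(D)$ has vertex set $V(D)$ and one hyperedge $V(C)$ for each directed cycle $C$ of $D$. Its dual $\mathcal{C}(D)^{*}$ has one vertex $v_C$ for each directed cycle $C$ of $D$ and, for each $v\in V(D)$, one hyperedge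 $e_v=\{v_C : v\in V(C)\}$ (hyperedges $e_u,e_v$ with $u\ne v$ are regarded as different even if they contain the same vertices; $e_v=\emptyset$ if $v$ lies on no directed cycle). Hyperbranch-width. A hyperbranch decomposition of a hypergraph $H$ is a pair $(T,\delta)$ where $T$ is an undirected tree of maximum degree at most three and $\delta$ is a bijection from the leaves of $T$ to the hyperedges $E(H)$. The thickness of $t_1t_2\in E(T)$ is the minimum size of a set $S\subseteq E(H)$ with $\big(\bigcup\delta(T_{t_1})\big)\cap\big(\bigcup\delta(T_{t_2})\big)\subseteq\bigcup S$. The width of $(T,\delta)$ is the maximum thickness of an edge of $T$, and $\mathrm{hbw}(H)$ is the minimum width of a hyperbranch decomposition of $H$. -}

module Defs where

open import Data.Fin using (Fin; _<_)
open import Data.List using (List; _∷_; [_]; _++_; length; filter; allFin)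
open import Data.List.Membership.Propositional using (_∈_)
open import Data.List.Relation.Unary.All using (All)
open import Data.List.Relation.Unary.Linked using (Linked)
open import Data.List.Relation.Unary.Unique.Propositional using (Unique)
open import Data.Nat using (ℕ; NonZero; _≤_)
open import Data.Product using (Σ; ∃; ∃-syntax; _×_; proj₁)
open import Data.Sum using (_⊎_)
open import Function.Bundles using (_⤖_; module Bijection)
open import Level using (Level; 0ℓ)
open import Relation.Binary.Construct.Closure.ReflexiveTransitive using (Star)
open import Relation.Binary.Core using (Rel)
open import Relation.Binary.Definitions using (Decidable; Symmetric)
open import Relation.Binary.PropositionalEquality using (_≡_)
open import Relation.Nullary using (¬_)
open import Relation.Unary using (Pred)

private
  variable
    a : Level
    A : Set
    m n : ℕ

-- Minima and maxima of sets of naturals are stated as relations: such a set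
-- has at most one minimum and at most one maximum.

IsMin : Pred ℕ a → Pred ℕ a
IsMin P k = P k × (∀ j → P j → k ≤ j)

IsMax : Pred ℕ a → Pred ℕ a
IsMax P k = P k × (∀ j → P j → j ≤ k)

-- "k is the least size of a finite set satisfying P"; finite sets are
-- duplicate-free lists.

IsMinSize : Pred (List A) 0ℓ → Pred ℕ 0ℓ
IsMinSize P = IsMin λ k → ∃[ S ] (Unique S × length S ≡ k × P S)

-- The vertices v ∷ vs are distinct, each has an edge to its successor, and
-- the last one has an edge back to v.

IsCycle : Rel A 0ℓ → A → List A → Set
IsCycle _⟶_ v vs = Unique (v ∷ vs) × Linked _⟶_ (v ∷ vs ++ [ v ])

------------------------------------------------------------------------
-- Digraphs

record Digraph (n : ℕ) : Set₁ where
  field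
    _⟶_      : Rel (Fin n) 0ℓ
    _⟶?_     : Decidable _⟶_
    loopless : ∀ v → ¬ (v ⟶ v)

-- A directed cycle is a cyclic sequence, i.e. rotations are identified. It is
-- represented by its unique listing that starts at the smallest vertex. The
-- proofs are irrelevant, so that equal listings give equal cycles.

record DirectedCycle (D : Digraph n) : Set where
  open Digraph D
  field
    start     : Fin n
    rest      : List (Fin n)
    .isCycle  : IsCycle _⟶_ start rest
    .smallest : All (start <_) rest

  vertices : List (Fin n)
  vertices = start ∷ rest

open DirectedCycle public using (vertices)

------------------------------------------------------------------------
-- Trees

record Graph (m : ℕ) : Set₁ where
  field
    _~_      : Rel (Fin m) 0ℓ
    _~?_     : Decidable _~_
    ~-sym    : Symmetric _~_
    loopless : ∀ v → ¬ (v ~ v)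

  degree : Fin m → ℕ
  degree v = length (filter (v ~?_) (allFin m))

  Connected : Set
  Connected = ∀ u v → Star _~_ u v

  -- An undirected cycle has at least three vertices.
  Acyclic : Set
  Acyclic = ∀ v vs → 2 ≤ length vs → ¬ IsCycle _~_ v vs

  -- Adjacency after deleting the edge between t₁ and t₂.
  Minus : (t₁ t₂ : Fin m) → Rel (Fin m) 0ℓ
  Minus t₁ t₂ u v = u ~ v × ¬ (u ≡ t₁ × v ≡ t₂) × ¬ (u ≡ t₂ × v ≡ t₁)

  -- For an edge t₁t₂ of a tree: the component containing t₁ after deleting
  -- that edge. The other component is Component t₂ t₁.
  Component : (t₁ t₂ : Fin m) → Pred (Fin m) 0ℓ
  Component t₁ t₂ = Star (Minus t₁ t₂) t₁

  -- In a connected graph degree 0 occurs only for the one-vertex graph, whose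
  -- vertex counts as a leaf.
  Leaf : Set
  Leaf = ∃[ v ] degree v ≤ 1

record IsTree (G : Graph m) : Set where
  open Graph G
  field
    nonempty  : NonZero m
    connected : Connected
    acyclic   : Acyclic

------------------------------------------------------------------------
-- Branch decompositions: shared by digraphs (A = vertices) and hypergraphs
-- (A = hyperedges)

record BranchDecomposition (A : Set) : Set₁ where
  field
    order     : ℕ
    T         : Graph order
    isTree    : IsTree T
    maxDegree : ∀ t → Graph.degree T t ≤ 3
    δ         : Graph.Leaf T ⤖ A

  open Graph T public
    using (_~_; Component; Leaf)

  -- δ(T_{t₁}) for the edge t₁t₂
  Image : (t₁ t₂ : Fin order) → Pred A 0ℓ
  Image t₁ t₂ x = ∃[ ℓ ] (Component t₁ t₂ (proj₁ ℓ) × Bijection.to δ ℓ ≡ x)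

-- "Thickness X Y k" says that an edge t₁t₂ with δ(T_{t₁}) = X and
-- δ(T_{t₂}) = Y has thickness k. Adjoining 0 to the thicknesses gives the
-- one-vertex tree width 0 and does not affect the maximum otherwise.

IsWidth : (Thickness : Pred A 0ℓ → Pred A 0ℓ → Pred ℕ 0ℓ) →
          BranchDecomposition A → Pred ℕ 0ℓ
IsWidth Thickness B = IsMax λ w →
  w ≡ 0 ⊎ ∃[ t₁ ] ∃[ t₂ ] (t₁ ~ t₂ × Thickness (Image t₁ t₂) (Image t₂ t₁) w)
  where open BranchDecomposition B

IsBranchWidth : (Thickness : Pred A 0ℓ → Pred A 0ℓ → Pred ℕ 0ℓ) →
                ℕ → Set₁
IsBranchWidth {A} Thickness =
  IsMin λ w → Σ (BranchDecomposition A) λ B → IsWidth Thickness B w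

------------------------------------------------------------------------
-- Directed branchwidth

HitsCrossingCycles : Digraph n → Pred (Fin n) 0ℓ → Pred (List (Fin n)) 0ℓ
HitsCrossingCycles D X S =
  (C : DirectedCycle D) →
  (∃[ v ] (v ∈ vertices C × X v)) →
  (∃[ v ] (v ∈ vertices C × ¬ X v)) →
  ∃[ v ] (v ∈ vertices C × v ∈ S)

-- "dbw(D) = k"
IsDbw : Digraph n → ℕ → Set₁
IsDbw D = IsBranchWidth λ X _ → IsMinSize (HitsCrossingCycles D X)

------------------------------------------------------------------------
-- Hypergraphs, as incidence structures: distinct hyperedges may contain the
-- same vertices

record Hypergraph : Set₁ where
  field
    V   : Set
    E   : Set
    _I_ : V → E → Set

  -- Union of a family of hyperedges
  ⋃ : Pred E 0ℓ → Pred V 0ℓ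
  ⋃ F x = ∃[ e ] (F e × x I e)

  CoversBoundary : Pred E 0ℓ → Pred E 0ℓ → Pred (List E) 0ℓ
  CoversBoundary X Y S = ∀ x → ⋃ X x → ⋃ Y x → ⋃ (_∈ S) x

dual : Hypergraph → Hypergraph
dual H = record { V = E ; E = V ; _I_ = λ e v → v I e }
  where open Hypergraph H

cycleHypergraph : Digraph n → Hypergraph
cycleHypergraph {n} D = record
  { V   = Fin n
  ; E   = DirectedCycle D
  ; _I_ = λ v C → v ∈ vertices C
  }

-- "hbw(H) = k"
IsHbw : Hypergraph → ℕ → Set₁
IsHbw H = IsBranchWidth λ X Y → IsMinSize (CoversBoundary X Y)
  where open Hypergraph H

{-# OPTIONS --safe #-}
-- For a fixed digraph both widths range over the same decompositions (T , δ),
-- since the hyperedges of the dual are the vertices of the digraph. For an edge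
-- t₁t₂ of T the families δ(T_{t₁}) and δ(T_{t₂}) are complementary, so a cycle
-- crosses the edge exactly when its dual vertex lies in both unions, and the
-- admissible sets S for the two notions of thickness coincide.
module Submission where

open import Data.Fin using (_≟_)
open import Data.List using (List; []; _∷_; [_]; _++_)
open import Data.List.Membership.Propositional using (_∈_)
open import Data.List.Relation.Unary.All.Properties using (¬Any⇒All¬)
open import Data.List.Relation.Unary.AllPairs using ([]; _∷_)
open import Data.List.Relation.Unary.All using ([])
open import Data.List.Relation.Unary.Any using (here; there)
open import Data.List.Relation.Unary.Linked using (Linked; [-]; _∷_)
open import Data.List.Relation.Unary.Unique.Propositional using (Unique)
open import Data.Nat using (ℕ; NonZero; z≤n; s≤s)
open import Data.Product using (_×_; _,_; ∃-syntax; proj₁; swap)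
import Data.Product as Product
open import Data.Sum using (_⊎_; inj₁; inj₂)
import Data.Sum as Sum
open import Data.Empty using (⊥-elim)
open import Function using (_∘_; id)
open import Function.Bundles using (_⇔_; mk⇔; module Bijection; module Equivalence)
open import Level using (0ℓ)
open import Relation.Binary.Construct.Closure.ReflexiveTransitive
  using (Star; ε; _◅_; _◅◅_; reverse; map)
open import Relation.Binary.Core using (Rel; _⇒_)
open import Relation.Binary.Definitions using (DecidableEquality)
open import Relation.Binary.PropositionalEquality using (_≡_; refl; sym; trans; cong; subst)
open import Relation.Nullary using (¬_; yes; no)
open import Relation.Nullary.Decidable using (_×-dec_)
open import Relation.Unary using (Pred)
open import Defs

open Equivalence using (to; from)

-- The index list omits the initial vertex, so `u ∷ vs` lists all vertices of the path, in the
-- format of `IsCycle`.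
data Path {A : Set} (R : Rel A 0ℓ) : A → List A → A → Set where
  []  : ∀ {v} → Path R v [] v
  _∷_ : ∀ {u v w vs} → R u w → Path R w vs v → Path R u (w ∷ vs) v

module _ {A : Set} {R : Rel A 0ℓ} where

  SimplePath : Rel A 0ℓ
  SimplePath u v = ∃[ vs ] (Path R u vs v × Unique (u ∷ vs))

  suffix : ∀ {x u vs v} → x ∈ u ∷ vs → Path R u vs v → Unique (u ∷ vs) → SimplePath x v
  suffix (here refl) p       uniq       = _ , p , uniq
  suffix (there x∈)  (_ ∷ p) (_ ∷ uniq) = suffix x∈ p uniq

  -- The step relation may grow from `R` to `S` because the path avoids an edge that is then used to
  -- close it up.
  close : ∀ {S : Rel A 0ℓ} {u vs v w} → R ⇒ S → Path R u vs v → S v w →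
          Linked S (u ∷ vs ++ [ w ])
  close R⇒S []      s = s ∷ [-]
  close R⇒S (r ∷ p) s = R⇒S r ∷ close R⇒S p s

  module _ (_≟ᴬ_ : DecidableEquality A) where
    open import Data.List.Membership.DecPropositional _≟ᴬ_ using (_∈?_)

    -- Loop erasure: when the vertex put in front already occurs on the simple path, only the suffix
    -- from that occurrence is kept.
    simplify : Star R ⇒ SimplePath
    simplify ε = [] , [] , [] ∷ []
    simplify (_◅_ {i = u} r rs) with simplify rs
    ... | vs , p , uniq with u ∈? (_ ∷ vs)
    ...   | yes u∈ = suffix u∈ p uniq
    ...   | no  u∉ = _ , r ∷ p , ¬Any⇒All¬ _ u∉ ∷ uniq

module TreeEdge {m} {G : Graph m} (tree : IsTree G) where
  open Graph G
  open IsTree tree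

  Minus-sym : ∀ {s t u v} → Minus s t u v → Minus s t v u
  Minus-sym (u~v , ≢st , ≢ts) = ~-sym u~v , ≢ts ∘ swap , ≢st ∘ swap

  Minus-flip : ∀ {s t} → Minus t s ⇒ Minus s t
  Minus-flip (u~v , ≢ts , ≢st) = u~v , ≢st , ≢ts

  -- A simple path from `s` to `t` avoiding the edge `st` cannot be that single edge, so it has at
  -- least two steps, and adding the edge back closes it into a cycle of the tree.
  separated : ∀ {s t} → s ~ t → ¬ Component s t t
  separated {s} {t} s~t walk with simplify _≟_ walk
  ... | _ , [] , _ = loopless s s~t
  ... | _ , (_ , ≢st , _) ∷ [] , _ = ≢st (refl , refl)
  ... | vs , p@(_ ∷ _ ∷ _) , uniq =
    acyclic s vs (s≤s (s≤s z≤n)) (uniq , close proj₁ p (~-sym s~t))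

  components-disjoint : ∀ {s t x} → s ~ t → Component s t x → ¬ Component t s x
  components-disjoint s~t c d =
    separated s~t (c ◅◅ reverse Minus-sym (map Minus-flip d))

  -- Follow a walk from `s` to `x`, recording which side the current vertex is on.
  components-cover : ∀ s t x → Component s t x ⊎ Component t s x
  components-cover s t x = go (inj₁ ε) (connected s x)
    where
    go : ∀ {u} → Component s t u ⊎ Component t s u → Star _~_ u x →
         Component s t x ⊎ Component t s x
    go c ε = c
    go {u} c (_◅_ {j = v} u~v walk)
      with (u ≟ s) ×-dec (v ≟ t) | (u ≟ t) ×-dec (v ≟ s)
    -- Crossing the deleted edge lands on `t` or `s` itself, so the record restarts with an empty
    -- walk; any other step extends the recorded one.
    ... | yes (_ , refl) | _              = go (inj₂ ε) walk
    ... | no _           | yes (_ , refl) = go (inj₁ ε) walk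
    ... | no ≢st         | no ≢ts         = go (Sum.map (_◅◅ (u~v , ≢st , ≢ts) ◅ ε)
                                                        (_◅◅ (u~v , ≢ts , ≢st) ◅ ε) c) walk

Complementary : ∀ {A : Set} → Pred A 0ℓ → Pred A 0ℓ → Set
Complementary X Y = ∀ x → Y x ⇔ (¬ X x)

-- Injectivity of `δ` reduces disjointness of the images to that of the components; surjectivity
-- supplies a leaf over `x`, which lies on one of the two sides.
images-complementary : ∀ {A} (B : BranchDecomposition A) {s t} →
  let open BranchDecomposition B in s ~ t → Complementary (Image s t) (Image t s)
images-complementary B {s} {t} s~t x = mk⇔ disjoint cover
  where
  open BranchDecomposition B
  open TreeEdge isTree

  disjoint : Image t s x → ¬ Image s t x
  disjoint (ℓ , d , δℓ≡x) (ℓ′ , c , δℓ′≡x) = components-disjoint s~t c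
    (subst (Component t s) (cong proj₁ (Bijection.injective δ (trans δℓ≡x (sym δℓ′≡x)))) d)

  cover : ¬ Image s t x → Image t s x
  cover ∉ with Bijection.strictlySurjective δ x
  ... | ℓ , δℓ≡x with components-cover s t (proj₁ ℓ)
  ...   | inj₁ c = ⊥-elim (∉ (ℓ , c , δℓ≡x))
  ...   | inj₂ d = ℓ , d , δℓ≡x

IsMin-cong : ∀ {a b} {P : Pred ℕ a} {Q : Pred ℕ b} → (∀ k → P k ⇔ Q k) →
             ∀ k → IsMin P k ⇔ IsMin Q k
IsMin-cong P⇔Q k = mk⇔
  (Product.map (to (P⇔Q k)) (λ least j → least j ∘ from (P⇔Q j)))
  (Product.map (from (P⇔Q k)) (λ least j → least j ∘ to (P⇔Q j)))

IsMax-cong : ∀ {a b} {P : Pred ℕ a} {Q : Pred ℕ b} → (∀ k → P k ⇔ Q k) →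
             ∀ k → IsMax P k ⇔ IsMax Q k
IsMax-cong P⇔Q k = mk⇔
  (Product.map (to (P⇔Q k)) (λ greatest j → greatest j ∘ from (P⇔Q j)))
  (Product.map (from (P⇔Q k)) (λ greatest j → greatest j ∘ to (P⇔Q j)))

IsMinSize-cong : ∀ {A : Set} {P Q : Pred (List A) 0ℓ} → (∀ S → P S ⇔ Q S) →
                 ∀ k → IsMinSize P k ⇔ IsMinSize Q k
IsMinSize-cong P⇔Q = IsMin-cong λ _ → mk⇔
  (λ (S , uniq , size , p) → S , uniq , size , to (P⇔Q S) p)
  (λ (S , uniq , size , q) → S , uniq , size , from (P⇔Q S) q)

module _ {A : Set} {Θ Θ′ : Pred A 0ℓ → Pred A 0ℓ → Pred ℕ 0ℓ}
         (Θ⇔Θ′ : ∀ {X Y} → Complementary X Y → ∀ k → Θ X Y k ⇔ Θ′ X Y k) where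

  -- Thickness is only ever evaluated at the two images of a tree edge, so agreement on
  -- complementary pairs suffices.
  IsWidth-cong : ∀ B w → IsWidth Θ B w ⇔ IsWidth Θ′ B w
  IsWidth-cong B = IsMax-cong λ w → mk⇔
    (Sum.map id λ (s , t , s~t , θ) →
      s , t , s~t , to (Θ⇔Θ′ (images-complementary B s~t) w) θ)
    (Sum.map id λ (s , t , s~t , θ) →
      s , t , s~t , from (Θ⇔Θ′ (images-complementary B s~t) w) θ)

  IsBranchWidth-cong : ∀ k → IsBranchWidth Θ k ⇔ IsBranchWidth Θ′ k
  IsBranchWidth-cong = IsMin-cong λ w → mk⇔
    (λ (B , width) → B , to (IsWidth-cong B w) width)
    (λ (B , width) → B , from (IsWidth-cong B w) width)

-- A vertex of the dual is a cycle `C`, and it lies in a union of hyperedges exactly when `C` passes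
-- through a vertex of the family. Beyond exchanging `¬ X` with `Y`, only the order of the conjuncts
-- changes.
hitsCrossingCycles⇔coversBoundary : ∀ {n} (D : Digraph n) {X Y} → Complementary X Y →
  ∀ S → HitsCrossingCycles D X S ⇔
        Hypergraph.CoversBoundary (dual (cycleHypergraph D)) X Y S
hitsCrossingCycles⇔coversBoundary D Y⇔¬X S = mk⇔
  (λ hits C (u , Xu , u∈C) (v , Yv , v∈C) →
    Product.map₂ swap (hits C (u , u∈C , Xu) (v , v∈C , to (Y⇔¬X v) Yv)))
  (λ covers C (u , u∈C , Xu) (v , v∈C , ¬Xv) →
    Product.map₂ swap (covers C (u , Xu , u∈C) (v , from (Y⇔¬X v) ¬Xv , v∈C)))

theorem3p7 : ∀ (n : ℕ) .{{_ : NonZero n}} (D : Digraph n) (k : ℕ) →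
    IsDbw D k ⇔ IsHbw (dual (cycleHypergraph D)) k
theorem3p7 n D = IsBranchWidth-cong λ Y⇔¬X →
  IsMinSize-cong (hitsCrossingCycles⇔coversBoundary D Y⇔¬X)
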